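{- The variety $\mathbf{V}(\mathrm{Lang}(+,\cdot,\circ,0,1))$ generated by the class of language algebras of similarity type $(+,\cdot,\circ,0,1)$ is axiomatized by the equation $(x\circ y)\cdot 1=(x\cdot 1)\circ(y\cdot 1)$ together with the set of equations $\mathrm{Ax}^i(+,\cdot,\circ,0,1)$.
   Context: An algebra $\mathfrak{A}=(A,+,\cdot,\circ,0,1)$ is a language algebra if there is an alphabet $\Sigma$ with $A\subseteq\wp(\Sigma^*)$ ($\Sigma^*$ the set of finite words over $\Sigma$), where $+$ is union, $\cdot$ is intersection, $\circ$ is concatenation $a\circ b=\{st: s\in a, t\in b\}$, $0$ is the empty language and $1$ is the language consisting only of the empty word. $\mathrm{Lang}(+,\cdot,\circ,0,1)$ is the class of such algebras, and $\mathbf{V}(K)$ denotes the variety generated by a class $K$. Conventions: $x\le y$ abbreviates $x\cdot y=x$; $\circ$ binds tighter than $\cdot$ and $+$. $\mathrm{Ax}^i(+,\cdot,\circ,0,1)$ consists of: the distributive lattice axioms for $+$ and $\cdot$; the monoid axioms for $\circ$ and $1$; monotonicity $(x\cdot x')\circ(y\cdot y')\le x\circ y$; $0=0\cdot x$; $0=0\circ x=x\circ 0$; $(1\cdot x)\circ(1\cdot y)=1\cdot x\cdot y$; $(1\cdot x)\circ(y\cdot z)=((1\cdot x)\circ y)\cdot z$; $(x\cdot y)\circ(1\cdot z)=x\cdot (y\circ(1\cdot z))$; $1\cdot(x\circ y)=1\cdot(y\circ x)$; $(1\cdot x)\circ y=y\circ(1\cdot x)$; and additivity $(x+y)\circ z=x\circ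 z+y\circ z$, $x\circ(y+z)=x\circ y+x\circ z$. -}

module Defs where

open import Level using (Level; _⊔_; suc; 0ℓ) renaming (zero to lzero)
open import Data.Nat using (ℕ)
open import Data.List using (List; []; _++_)
open import Data.Product using (Σ; ∃; _×_; _,_; proj₁; proj₂)
open import Data.Sum using (_⊎_)
open import Data.Empty using (⊥)
open import Function using (_⇔_)
open import Function.Bundles using (Equivalence; mk⇔)
open import Relation.Binary using (IsEquivalence)
open import Relation.Binary.PropositionalEquality using (_≡_)

infixl 6 _⊕_
infixl 7 _⊗_
infixl 8 _⊙_

data Term : Set where
  var : ℕ → Term
  _⊕_ : Term → Term → Term
  _⊗_ : Term → Term → Term
  _⊙_ : Term → Term → Term
  𝟘 : Term
  𝟙 : Term

record Algebra (a ℓ : Level) : Set (suc (a ⊔ ℓ)) where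
  field
    Carrier : Set a
    _≈_     : Carrier → Carrier → Set ℓ
    isEquivalence : IsEquivalence _≈_
    _+_ _·_ _∘_ : Carrier → Carrier → Carrier
    0# 1# : Carrier
    +-cong : ∀ {x x' y y'} → x ≈ x' → y ≈ y' → (x + y) ≈ (x' + y')
    ·-cong : ∀ {x x' y y'} → x ≈ x' → y ≈ y' → (x · y) ≈ (x' · y')
    ∘-cong : ∀ {x x' y y'} → x ≈ x' → y ≈ y' → (x ∘ y) ≈ (x' ∘ y')

module _ {a ℓ : Level} (A : Algebra a ℓ) where
  open Algebra A

  ⟦_⟧ : Term → (ℕ → Carrier) → Carrier
  ⟦ var i ⟧ ρ = ρ i
  ⟦ s ⊕ t ⟧ ρ = ⟦ s ⟧ ρ + ⟦ t ⟧ ρ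
  ⟦ s ⊗ t ⟧ ρ = ⟦ s ⟧ ρ · ⟦ t ⟧ ρ
  ⟦ s ⊙ t ⟧ ρ = ⟦ s ⟧ ρ ∘ ⟦ t ⟧ ρ
  ⟦ 𝟘 ⟧ ρ = 0#
  ⟦ 𝟙 ⟧ ρ = 1#

  Satisfies : Term → Term → Set (a ⊔ ℓ)
  Satisfies s t = ∀ (ρ : ℕ → Carrier) → ⟦ s ⟧ ρ ≈ ⟦ t ⟧ ρ

Language : Set → Set₁
Language S = List S → Set

module LangOps (S : Set) where
  _∪_ : Language S → Language S → Language S
  (L ∪ M) w = L w ⊎ M w

  _∩_ : Language S → Language S → Language S
  (L ∩ M) w = L w × M w

  _⨾_ : Language S → Language S → Language S
  (L ⨾ M) w = ∃ λ u → ∃ λ v → (w ≡ u ++ v) × L u × M v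

  ∅ : Language S
  ∅ w = ⊥

  ε : Language S
  ε w = w ≡ []

  _≐_ : Language S → Language S → Set
  L ≐ M = ∀ w → (L w ⇔ M w)

record LanguageAlgebra : Set₂ where
  field
    Alphabet : Set
  open LangOps Alphabet public
  field
    InA : Language Alphabet → Set₁
    ∪-closed : ∀ {L M} → InA L → InA M → InA (L ∪ M)
    ∩-closed : ∀ {L M} → InA L → InA M → InA (L ∩ M)
    ⨾-closed : ∀ {L M} → InA L → InA M → InA (L ⨾ M)
    ∅-closed : InA ∅
    ε-closed : InA ε

toAlgebra : LanguageAlgebra → Algebra (suc 0ℓ) 0ℓ
toAlgebra 𝔏 = record
  { Carrier = Σ (Language Alphabet) InA
  ; _≈_ = λ L M → proj₁ L ≐ proj₁ M
  ; isEquivalence = record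
      { refl = λ w → mk⇔ (λ q → q) (λ q → q)
      ; sym = λ e w → mk⇔ (from (e w)) (to (e w))
      ; trans = λ e f w → mk⇔ (λ q → to (f w) (to (e w) q)) (λ q → from (e w) (from (f w) q))
      }
  ; _+_ = λ L M → (proj₁ L ∪ proj₁ M) , ∪-closed (proj₂ L) (proj₂ M)
  ; _·_ = λ L M → (proj₁ L ∩ proj₁ M) , ∩-closed (proj₂ L) (proj₂ M)
  ; _∘_ = λ L M → (proj₁ L ⨾ proj₁ M) , ⨾-closed (proj₂ L) (proj₂ M)
  ; 0# = ∅ , ∅-closed
  ; 1# = ε , ε-closed
  ; +-cong = λ e f w → mk⇔ (S.map (to (e w)) (to (f w))) (S.map (from (e w)) (from (f w)))
  ; ·-cong = λ e f w → mk⇔ (P.map (to (e w)) (to (f w))) (P.map (from (e w)) (from (f w)))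
  ; ∘-cong = λ e f w → mk⇔
      (λ { (u , v , p , q , r) → u , v , p , to (e u) q , to (f v) r })
      (λ { (u , v , p , q , r) → u , v , p , from (e u) q , from (f v) r })
  }
  where
    open LanguageAlgebra 𝔏
    open Equivalence
    import Data.Sum as S
    import Data.Product as P

LangValid : Term → Term → Set₂
LangValid s t = ∀ (𝔏 : LanguageAlgebra) → Satisfies (toAlgebra 𝔏) s t

x y z x' y' : Term
x = var 0
y = var 1
z = var 2
x' = var 3
y' = var 4

-- p ≤ q abbreviates p · q = p
data Ax : Term → Term → Set where
  +-comm   : Ax (x ⊕ y) (y ⊕ x)
  ·-comm   : Ax (x ⊗ y) (y ⊗ x)
  +-assoc  : Ax ((x ⊕ y) ⊕ z) (x ⊕ (y ⊕ z))
  ·-assoc  : Ax ((x ⊗ y) ⊗ z) (x ⊗ (y ⊗ z))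
  +-absorb : Ax (x ⊕ (x ⊗ y)) x
  ·-absorb : Ax (x ⊗ (x ⊕ y)) x
  distrib  : Ax (x ⊗ (y ⊕ z)) ((x ⊗ y) ⊕ (x ⊗ z))
  ∘-assoc  : Ax ((x ⊙ y) ⊙ z) (x ⊙ (y ⊙ z))
  ∘-idˡ    : Ax (𝟙 ⊙ x) x
  ∘-idʳ    : Ax (x ⊙ 𝟙) x
  -- monotonicity (x·x')∘(y·y') ≤ x∘y
  mono     : Ax (((x ⊗ x') ⊙ (y ⊗ y')) ⊗ (x ⊙ y)) ((x ⊗ x') ⊙ (y ⊗ y'))
  zero-·   : Ax 𝟘 (𝟘 ⊗ x)
  zero-∘ˡ  : Ax 𝟘 (𝟘 ⊙ x)
  zero-∘ʳ  : Ax 𝟘 (x ⊙ 𝟘)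
  ax1      : Ax ((𝟙 ⊗ x) ⊙ (𝟙 ⊗ y)) ((𝟙 ⊗ x) ⊗ y)
  ax2      : Ax ((𝟙 ⊗ x) ⊙ (y ⊗ z)) (((𝟙 ⊗ x) ⊙ y) ⊗ z)
  ax3      : Ax ((x ⊗ y) ⊙ (𝟙 ⊗ z)) (x ⊗ (y ⊙ (𝟙 ⊗ z)))
  ax4      : Ax (𝟙 ⊗ (x ⊙ y)) (𝟙 ⊗ (y ⊙ x))
  ax5      : Ax ((𝟙 ⊗ x) ⊙ y) (y ⊙ (𝟙 ⊗ x))
  addˡ     : Ax ((x ⊕ y) ⊙ z) ((x ⊙ z) ⊕ (y ⊙ z))
  addʳ     : Ax (x ⊙ (y ⊕ z)) ((x ⊙ y) ⊕ (x ⊙ z))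
  extra    : Ax ((x ⊙ y) ⊗ 𝟙) ((x ⊗ 𝟙) ⊙ (y ⊗ 𝟙))

ModelOfAx : ∀ {a ℓ} → Algebra a ℓ → Set (a ⊔ ℓ)
ModelOfAx A = ∀ {s t} → Ax s t → Satisfies A s t

-- A ∈ V(Lang(+,·,∘,0,1)), via Birkhoff's HSP theorem: A satisfies every
-- equation valid in all language algebras.
InVarietyLang : ∀ {a ℓ} → Algebra a ℓ → Set (suc (suc lzero) ⊔ a ⊔ ℓ)
InVarietyLang A = ∀ s t → LangValid s t → Satisfies A s t

{-# OPTIONS --safe #-}
module Submission where

-- Modulo Ax, elements below 1 are central scalars, and 1 · (x ∘ y) = 1 · x · y by the extra
-- equation.  Hence every term is a sum of normal terms: tests σ = x₁ · … · xₖ · 1, and products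
-- σ ∘ q with q built from variables by ∘ and · only.
--
-- Read q as a two-terminal series-parallel graph whose edges are variables, and number its
-- vertices injectively and increasingly along paths.  The word of a path i ⟶ j is the interval of
-- natural numbers between the numbers of i and j, so that cutting such a word in two parts that
-- both come from paths is the same as choosing an intermediate vertex.  The part of the graph
-- between i and j is again (the graph of) a term, label i j, and label i k ≤ label i j ∘ label j k.
-- Letting a variable x contain the word of i ⟶ j when σ ∘ label i j ≤ x is derivable, and the empty
-- word when σ ≤ x is, one finds by induction on t that the word of source ⟶ sink lies in t only if
-- σ ∘ q ≤ t is derivable, while it does lie in σ ∘ q.

open import Defs
open import Level using (Level; 0ℓ)
open import Function using (_⇔_; id; _∘′_)
open import Function.Bundles using (Equivalence; mk⇔)
open import Algebra.Lattice using (Lattice)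
import Algebra.Lattice.Properties.Lattice as LatticeProperties
open import Data.Empty using (⊥)
open import Data.List using (List; []; _∷_; _++_; map; cartesianProductWith)
open import Data.List.Membership.Propositional using (_∈_)
open import Data.List.Properties using (++-assoc; ++-identityʳ)
open import Data.List.Relation.Unary.Any using (here; there)
open import Data.Nat using (ℕ; zero; suc; z≤n; s≤s; _≤′_; ≤′-reflexive; ≤′-step) renaming (_+_ to _+ℕ_; _≤_ to _≤ℕ_; _<_ to _<ℕ_)
import Data.Nat.Properties as ℕ
open import Data.Product using (∃; _×_; _,_; proj₁; proj₂; swap; assocʳ′; assocˡ′)
open import Data.Sum using (inj₁; inj₂; [_,_]′; assocʳ; assocˡ) renaming (swap to swap-⊎)
open import Data.Unit.Polymorphic using (⊤)
open import Relation.Binary using (IsEquivalence; Setoid; Poset)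
import Relation.Binary.Lattice as OrderTheoretic
open import Relation.Binary.PropositionalEquality as ≡ using (_≡_; refl)
import Relation.Binary.Reasoning.PartialOrder as PartialOrderReasoning
import Relation.Binary.Reasoning.Setoid as SetoidReasoning
open import Relation.Nullary using (contradiction)

private
  variable
    a ℓ : Level
    r s t u σ τ : Term

-- Equational logic of Ax

substitute : (ℕ → Term) → Term → Term
substitute θ (var i) = θ i
substitute θ (s ⊕ t) = substitute θ s ⊕ substitute θ t
substitute θ (s ⊗ t) = substitute θ s ⊗ substitute θ t
substitute θ (s ⊙ t) = substitute θ s ⊙ substitute θ t
substitute θ 𝟘 = 𝟘
substitute θ 𝟙 = 𝟙

infix 4 _≈_

-- Birkhoff's equational calculus, with substitution built into the rule `axiom`: terms modulo `_≈_`
-- form the free model of `Ax` on the variables.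
data _≈_ : Term → Term → Set where
  ≈-refl  : s ≈ s
  ≈-sym   : s ≈ t → t ≈ s
  ≈-trans : s ≈ t → t ≈ u → s ≈ u
  ⊕-cong  : r ≈ s → t ≈ u → r ⊕ t ≈ s ⊕ u
  ⊗-cong  : r ≈ s → t ≈ u → r ⊗ t ≈ s ⊗ u
  ⊙-cong  : r ≈ s → t ≈ u → r ⊙ t ≈ s ⊙ u
  axiom   : Ax s t → ∀ θ → substitute θ s ≈ substitute θ t

module _ (A : Algebra a ℓ) where
  open Algebra A using (Carrier; isEquivalence; _+_; _·_; _∘_; +-cong; ·-cong; ∘-cong)
  private
    module E = IsEquivalence isEquivalence

  ⟦substitute⟧ : ∀ s θ (ρ : ℕ → Carrier) →
                 ⟦ A ⟧ (substitute θ s) ρ ≡ ⟦ A ⟧ s (λ i → ⟦ A ⟧ (θ i) ρ)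
  ⟦substitute⟧ (var i) θ ρ = refl
  ⟦substitute⟧ (s ⊕ t) θ ρ = ≡.cong₂ _+_ (⟦substitute⟧ s θ ρ) (⟦substitute⟧ t θ ρ)
  ⟦substitute⟧ (s ⊗ t) θ ρ = ≡.cong₂ _·_ (⟦substitute⟧ s θ ρ) (⟦substitute⟧ t θ ρ)
  ⟦substitute⟧ (s ⊙ t) θ ρ = ≡.cong₂ _∘_ (⟦substitute⟧ s θ ρ) (⟦substitute⟧ t θ ρ)
  ⟦substitute⟧ 𝟘 θ ρ = refl
  ⟦substitute⟧ 𝟙 θ ρ = refl

  ≈-sound : ModelOfAx A → s ≈ t → Satisfies A s t
  ≈-sound ⊨Ax ≈-refl ρ = E.refl
  ≈-sound ⊨Ax (≈-sym d) ρ = E.sym (≈-sound ⊨Ax d ρ)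
  ≈-sound ⊨Ax (≈-trans d e) ρ = E.trans (≈-sound ⊨Ax d ρ) (≈-sound ⊨Ax e ρ)
  ≈-sound ⊨Ax (⊕-cong d e) ρ = +-cong (≈-sound ⊨Ax d ρ) (≈-sound ⊨Ax e ρ)
  ≈-sound ⊨Ax (⊗-cong d e) ρ = ·-cong (≈-sound ⊨Ax d ρ) (≈-sound ⊨Ax e ρ)
  ≈-sound ⊨Ax (⊙-cong d e) ρ = ∘-cong (≈-sound ⊨Ax d ρ) (≈-sound ⊨Ax e ρ)
  ≈-sound ⊨Ax (axiom {s} {t} α θ) ρ =
    E.trans (E.reflexive (⟦substitute⟧ s θ ρ))
      (E.trans (⊨Ax α _) (E.reflexive (≡.sym (⟦substitute⟧ t θ ρ))))

instance₁ : Term → ℕ → Term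
instance₁ r _ = r

instance₂ : Term → Term → ℕ → Term
instance₂ r s zero = r
instance₂ r s _ = s

instance₃ : Term → Term → Term → ℕ → Term
instance₃ r s t zero = r
instance₃ r s t (suc i) = instance₂ s t i

instance₅ : Term → Term → Term → Term → Term → ℕ → Term
instance₅ r s t u v zero = r
instance₅ r s t u v (suc zero) = s
instance₅ r s t u v (suc (suc i)) = instance₃ t u v i

≈-isEquivalence : IsEquivalence _≈_
≈-isEquivalence = record { refl = ≈-refl ; sym = ≈-sym ; trans = ≈-trans }

≈-setoid : Setoid 0ℓ 0ℓ
≈-setoid = record { isEquivalence = ≈-isEquivalence }

⊗-comm : ∀ s t → s ⊗ t ≈ t ⊗ s
⊗-comm s t = axiom ·-comm (instance₂ s t)

⊗-assoc : ∀ s t u → (s ⊗ t) ⊗ u ≈ s ⊗ (t ⊗ u)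
⊗-assoc s t u = axiom ·-assoc (instance₃ s t u)

⊙-assoc : ∀ s t u → (s ⊙ t) ⊙ u ≈ s ⊙ (t ⊙ u)
⊙-assoc s t u = axiom ∘-assoc (instance₃ s t u)

termLattice : Lattice 0ℓ 0ℓ
termLattice = record
  { _∨_ = _⊕_
  ; _∧_ = _⊗_
  ; isLattice = record
    { isEquivalence = ≈-isEquivalence
    ; ∨-comm = λ s t → axiom +-comm (instance₂ s t)
    ; ∨-assoc = λ s t u → axiom +-assoc (instance₃ s t u)
    ; ∨-cong = ⊕-cong
    ; ∧-comm = ⊗-comm
    ; ∧-assoc = ⊗-assoc
    ; ∧-cong = ⊗-cong
    ; absorptive = (λ s t → axiom +-absorb (instance₂ s t)) , (λ s t → axiom ·-absorb (instance₂ s t))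
    }
  }

-- Here `s ≤ t` unfolds to `s ≈ s ⊗ t`, so a proof of an inequality is used below directly as an
-- equation.
open LatticeProperties termLattice using (poset; ∨-∧-orderTheoreticLattice; ∧-idem)
open Poset poset using (_≤_) renaming (refl to ≤-refl; trans to ≤-trans; antisym to ≤-antisym; reflexive to ≤-reflexive)
open OrderTheoretic.Lattice ∨-∧-orderTheoreticLattice using () renaming
  (x≤x∨y to ⊕-upperˡ; y≤x∨y to ⊕-upperʳ; ∨-least to ⊕-least; x∧y≤x to ⊗-lowerˡ; x∧y≤y to ⊗-lowerʳ; ∧-greatest to ⊗-greatest)

𝟘-minimum : ∀ s → 𝟘 ≤ s
𝟘-minimum s = axiom zero-· (instance₁ s)

⊙-mono : r ≤ s → t ≤ u → r ⊙ t ≤ s ⊙ u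
⊙-mono {r} {s} {t} {u} r≤s t≤u = begin
  r ⊙ t                                  ≈⟨ ⊙-cong (meet r≤s) (meet t≤u) ⟩
  -- The instance of `mono` with `s`, `u` for `x`, `y` and `r`, `t` for `x'`, `y'`; `𝟘` is a filler
  -- at the index of `z`.
  (s ⊗ r) ⊙ (u ⊗ t)                      ≈⟨ axiom mono (instance₅ s u 𝟘 r t) ⟨
  ((s ⊗ r) ⊙ (u ⊗ t)) ⊗ (s ⊙ u)          ≈⟨ ⊗-cong (⊙-cong (meet r≤s) (meet t≤u)) ≈-refl ⟨
  (r ⊙ t) ⊗ (s ⊙ u)                      ≤⟨ ⊗-lowerʳ _ _ ⟩
  s ⊙ u                                  ∎
  where
  open PartialOrderReasoning poset
  meet : ∀ {p q} → p ≤ q → p ≈ q ⊗ p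
  meet p≤q = ≈-trans p≤q (⊗-comm _ _)

-- Elements below 𝟙

module _ where
  open SetoidReasoning ≈-setoid

  below-𝟙 : σ ≤ 𝟙 → σ ≈ 𝟙 ⊗ σ
  below-𝟙 σ≤𝟙 = ≈-trans σ≤𝟙 (⊗-comm _ _)

  test-⊙-test : σ ≤ 𝟙 → τ ≤ 𝟙 → σ ⊙ τ ≈ σ ⊗ τ
  test-⊙-test {σ} {τ} σ≤𝟙 τ≤𝟙 = begin
    σ ⊙ τ              ≈⟨ ⊙-cong (below-𝟙 σ≤𝟙) (below-𝟙 τ≤𝟙) ⟩
    (𝟙 ⊗ σ) ⊙ (𝟙 ⊗ τ)  ≈⟨ axiom ax1 (instance₂ σ τ) ⟩
    (𝟙 ⊗ σ) ⊗ τ        ≈⟨ ⊗-cong (below-𝟙 σ≤𝟙) ≈-refl ⟨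
    σ ⊗ τ              ∎

  test-central : σ ≤ 𝟙 → ∀ s → σ ⊙ s ≈ s ⊙ σ
  test-central {σ} σ≤𝟙 s = begin
    σ ⊙ s        ≈⟨ ⊙-cong (below-𝟙 σ≤𝟙) ≈-refl ⟩
    (𝟙 ⊗ σ) ⊙ s  ≈⟨ axiom ax5 (instance₂ σ s) ⟩
    s ⊙ (𝟙 ⊗ σ)  ≈⟨ ⊙-cong ≈-refl (below-𝟙 σ≤𝟙) ⟨
    s ⊙ σ        ∎

  test-⊙-⊗ : σ ≤ 𝟙 → ∀ s t → σ ⊙ (s ⊗ t) ≈ (σ ⊙ s) ⊗ t
  test-⊙-⊗ {σ} σ≤𝟙 s t = begin
    σ ⊙ (s ⊗ t)        ≈⟨ ⊙-cong (below-𝟙 σ≤𝟙) ≈-refl ⟩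
    (𝟙 ⊗ σ) ⊙ (s ⊗ t)  ≈⟨ axiom ax2 (instance₃ σ s t) ⟩
    ((𝟙 ⊗ σ) ⊙ s) ⊗ t  ≈⟨ ⊗-cong (⊙-cong (below-𝟙 σ≤𝟙) ≈-refl) ≈-refl ⟨
    (σ ⊙ s) ⊗ t        ∎

  -- This is where `extra` enters: below `𝟙` a composition splits into `(s ⊗ 𝟙) ⊙ (t ⊗ 𝟙)`, which
  -- `ax1` turns into a meet. In terms of languages, the empty word lies in a composition exactly
  -- when it lies in both factors.
  test-⊗-⊙ : σ ≤ 𝟙 → ∀ s t → σ ⊗ (s ⊙ t) ≈ (σ ⊗ s) ⊗ t
  test-⊗-⊙ {σ} σ≤𝟙 s t = begin
    σ ⊗ (s ⊙ t)              ≈⟨ ⊗-cong σ≤𝟙 (≈-refl {s ⊙ t}) ⟩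
    (σ ⊗ 𝟙) ⊗ (s ⊙ t)        ≈⟨ ⊗-assoc σ 𝟙 _ ⟩
    σ ⊗ (𝟙 ⊗ (s ⊙ t))        ≈⟨ ⊗-cong ≈-refl (⊗-comm 𝟙 _) ⟩
    σ ⊗ ((s ⊙ t) ⊗ 𝟙)        ≈⟨ ⊗-cong ≈-refl (axiom extra (instance₂ s t)) ⟩
    σ ⊗ ((s ⊗ 𝟙) ⊙ (t ⊗ 𝟙))  ≈⟨ ⊗-cong ≈-refl (⊙-cong (⊗-comm s 𝟙) (⊗-comm t 𝟙)) ⟩
    σ ⊗ ((𝟙 ⊗ s) ⊙ (𝟙 ⊗ t))  ≈⟨ ⊗-cong ≈-refl (axiom ax1 (instance₂ s t)) ⟩
    σ ⊗ ((𝟙 ⊗ s) ⊗ t)        ≈⟨ ⊗-cong ≈-refl (⊗-assoc 𝟙 s t) ⟩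
    σ ⊗ (𝟙 ⊗ (s ⊗ t))        ≈⟨ ⊗-assoc σ 𝟙 _ ⟨
    (σ ⊗ 𝟙) ⊗ (s ⊗ t)        ≈⟨ ⊗-cong σ≤𝟙 ≈-refl ⟨
    σ ⊗ (s ⊗ t)              ≈⟨ ⊗-assoc σ s t ⟨
    (σ ⊗ s) ⊗ t              ∎

  guarded-⊙ : σ ≤ 𝟙 → τ ≤ 𝟙 → ∀ s t → (σ ⊙ s) ⊙ (τ ⊙ t) ≈ (σ ⊗ τ) ⊙ (s ⊙ t)
  guarded-⊙ {σ} {τ} σ≤𝟙 τ≤𝟙 s t = begin
    (σ ⊙ s) ⊙ (τ ⊙ t)  ≈⟨ ⊙-assoc σ s _ ⟩
    σ ⊙ (s ⊙ (τ ⊙ t))  ≈⟨ ⊙-cong ≈-refl (⊙-assoc s τ t) ⟨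
    σ ⊙ ((s ⊙ τ) ⊙ t)  ≈⟨ ⊙-cong ≈-refl (⊙-cong (test-central τ≤𝟙 s) ≈-refl) ⟨
    σ ⊙ ((τ ⊙ s) ⊙ t)  ≈⟨ ⊙-cong ≈-refl (⊙-assoc τ s t) ⟩
    σ ⊙ (τ ⊙ (s ⊙ t))  ≈⟨ ⊙-assoc σ τ _ ⟨
    (σ ⊙ τ) ⊙ (s ⊙ t)  ≈⟨ ⊙-cong (test-⊙-test σ≤𝟙 τ≤𝟙) ≈-refl ⟩
    (σ ⊗ τ) ⊙ (s ⊙ t)  ∎

  guarded-⊗ : σ ≤ 𝟙 → τ ≤ 𝟙 → ∀ s t → (σ ⊙ s) ⊗ (τ ⊙ t) ≈ (σ ⊗ τ) ⊙ (s ⊗ t)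
  guarded-⊗ {σ} {τ} σ≤𝟙 τ≤𝟙 s t = begin
    (σ ⊙ s) ⊗ (τ ⊙ t)  ≈⟨ test-⊙-⊗ σ≤𝟙 s _ ⟨
    σ ⊙ (s ⊗ (τ ⊙ t))  ≈⟨ ⊙-cong ≈-refl (⊗-comm s _) ⟩
    σ ⊙ ((τ ⊙ t) ⊗ s)  ≈⟨ ⊙-cong ≈-refl (test-⊙-⊗ τ≤𝟙 t s) ⟨
    σ ⊙ (τ ⊙ (t ⊗ s))  ≈⟨ ⊙-assoc σ τ _ ⟨
    (σ ⊙ τ) ⊙ (t ⊗ s)  ≈⟨ ⊙-cong (test-⊙-test σ≤𝟙 τ≤𝟙) (⊗-comm t s) ⟩
    (σ ⊗ τ) ⊙ (s ⊗ t)  ∎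

-- Normal forms

infixl 8 _⨟_
infixl 7 _∧_

data SP : Set where
  atom : ℕ → SP
  _⨟_ _∧_ : SP → SP → SP

⌜_⌝ : SP → Term
⌜ atom i ⌝ = var i
⌜ p ⨟ q ⌝ = ⌜ p ⌝ ⊙ ⌜ q ⌝
⌜ p ∧ q ⌝ = ⌜ p ⌝ ⊗ ⌜ q ⌝

vars : SP → List ℕ
vars (atom i) = i ∷ []
vars (p ⨟ q) = vars p ++ vars q
vars (p ∧ q) = vars p ++ vars q

test : List ℕ → Term
test [] = 𝟙
test (i ∷ X) = var i ⊗ test X

test≤𝟙 : ∀ X → test X ≤ 𝟙
test≤𝟙 [] = ≤-refl
test≤𝟙 (i ∷ X) = ≤-trans (⊗-lowerʳ _ _) (test≤𝟙 X)

⊗-≤𝟙 : σ ≤ 𝟙 → ∀ s → σ ⊗ s ≤ 𝟙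
⊗-≤𝟙 σ≤𝟙 s = ≤-trans (⊗-lowerˡ _ _) σ≤𝟙

test-++ : ∀ X Y → test (X ++ Y) ≈ test X ⊗ test Y
test-++ [] Y = below-𝟙 (test≤𝟙 Y)
test-++ (i ∷ X) Y = ≈-trans (⊗-cong ≈-refl (test-++ X Y)) (≈-sym (⊗-assoc _ _ _))

module _ where
  open SetoidReasoning ≈-setoid

  -- Composition and meet coincide below `𝟙`, so under a test the shape of `q` is lost and only its
  -- variables survive.
  test-⊗-SP : σ ≤ 𝟙 → ∀ q → σ ⊗ ⌜ q ⌝ ≈ σ ⊗ test (vars q)
  test-⊗-SP-pair : σ ≤ 𝟙 → ∀ p q → (σ ⊗ ⌜ p ⌝) ⊗ ⌜ q ⌝ ≈ σ ⊗ test (vars p ++ vars q)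

  test-⊗-SP {σ} σ≤𝟙 (atom i) = begin
    σ ⊗ var i        ≈⟨ ⊗-cong σ≤𝟙 ≈-refl ⟩
    (σ ⊗ 𝟙) ⊗ var i  ≈⟨ ⊗-assoc σ 𝟙 _ ⟩
    σ ⊗ (𝟙 ⊗ var i)  ≈⟨ ⊗-cong ≈-refl (⊗-comm 𝟙 _) ⟩
    σ ⊗ (var i ⊗ 𝟙)  ∎
  test-⊗-SP σ≤𝟙 (p ⨟ q) = ≈-trans (test-⊗-⊙ σ≤𝟙 ⌜ p ⌝ ⌜ q ⌝) (test-⊗-SP-pair σ≤𝟙 p q)
  test-⊗-SP σ≤𝟙 (p ∧ q) = ≈-trans (≈-sym (⊗-assoc _ _ _)) (test-⊗-SP-pair σ≤𝟙 p q)

  test-⊗-SP-pair {σ} σ≤𝟙 p q = begin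
    (σ ⊗ ⌜ p ⌝) ⊗ ⌜ q ⌝                    ≈⟨ ⊗-cong (test-⊗-SP σ≤𝟙 p) ≈-refl ⟩
    (σ ⊗ test (vars p)) ⊗ ⌜ q ⌝            ≈⟨ test-⊗-SP (⊗-≤𝟙 σ≤𝟙 _) q ⟩
    (σ ⊗ test (vars p)) ⊗ test (vars q)    ≈⟨ ⊗-assoc _ _ _ ⟩
    σ ⊗ (test (vars p) ⊗ test (vars q))    ≈⟨ ⊗-cong ≈-refl (test-++ (vars p) _) ⟨
    σ ⊗ test (vars p ++ vars q)            ∎

infix 4 _▹_

data Normal : Set where
  only : List ℕ → Normal
  _▹_  : List ℕ → SP → Normal

⌊_⌋ : Normal → Term
⌊ only X ⌋ = test X
⌊ X ▹ q ⌋ = test X ⊙ ⌜ q ⌝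

_⊙ₙ_ : Normal → Normal → Normal
only X ⊙ₙ only Y = only (X ++ Y)
only X ⊙ₙ (Y ▹ q) = X ++ Y ▹ q
(X ▹ p) ⊙ₙ only Y = Y ++ X ▹ p
(X ▹ p) ⊙ₙ (Y ▹ q) = X ++ Y ▹ p ⨟ q

-- In the mixed cases the meet is below `𝟙`, so the series-parallel factor dissolves into a test on
-- its variables.
_⊗ₙ_ : Normal → Normal → Normal
only X ⊗ₙ only Y = only (X ++ Y)
only X ⊗ₙ (Y ▹ q) = only ((X ++ Y) ++ vars q)
(X ▹ p) ⊗ₙ only Y = only ((Y ++ X) ++ vars p)
(X ▹ p) ⊗ₙ (Y ▹ q) = X ++ Y ▹ p ∧ q

module _ where
  open SetoidReasoning ≈-setoid

  test-++-⊙ : ∀ X Y s → test X ⊙ (test Y ⊙ s) ≈ test (X ++ Y) ⊙ s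
  test-++-⊙ X Y s = begin
    test X ⊙ (test Y ⊙ s)  ≈⟨ ⊙-assoc _ _ _ ⟨
    (test X ⊙ test Y) ⊙ s  ≈⟨ ⊙-cong (test-⊙-test (test≤𝟙 X) (test≤𝟙 Y)) ≈-refl ⟩
    (test X ⊗ test Y) ⊙ s  ≈⟨ ⊙-cong (test-++ X Y) ≈-refl ⟨
    test (X ++ Y) ⊙ s      ∎

  test-⊗-guarded : ∀ X Y q → test X ⊗ (test Y ⊙ ⌜ q ⌝) ≈ test ((X ++ Y) ++ vars q)
  test-⊗-guarded X Y q = begin
    test X ⊗ (test Y ⊙ ⌜ q ⌝)         ≈⟨ test-⊗-⊙ (test≤𝟙 X) _ _ ⟩
    (test X ⊗ test Y) ⊗ ⌜ q ⌝         ≈⟨ test-⊗-SP (⊗-≤𝟙 (test≤𝟙 X) _) q ⟩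
    (test X ⊗ test Y) ⊗ test (vars q) ≈⟨ ⊗-cong (test-++ X Y) ≈-refl ⟨
    test (X ++ Y) ⊗ test (vars q)     ≈⟨ test-++ (X ++ Y) _ ⟨
    test ((X ++ Y) ++ vars q)         ∎

  ⊙ₙ-correct : ∀ m n → ⌊ m ⊙ₙ n ⌋ ≈ ⌊ m ⌋ ⊙ ⌊ n ⌋
  ⊙ₙ-correct (only X) (only Y) =
    ≈-trans (test-++ X Y) (≈-sym (test-⊙-test (test≤𝟙 X) (test≤𝟙 Y)))
  ⊙ₙ-correct (only X) (Y ▹ q) = ≈-sym (test-++-⊙ X Y ⌜ q ⌝)
  ⊙ₙ-correct (X ▹ p) (only Y) =
    ≈-trans (≈-sym (test-++-⊙ Y X ⌜ p ⌝)) (test-central (test≤𝟙 Y) _)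
  ⊙ₙ-correct (X ▹ p) (Y ▹ q) =
    ≈-trans (⊙-cong (test-++ X Y) ≈-refl) (≈-sym (guarded-⊙ (test≤𝟙 X) (test≤𝟙 Y) _ _))

  ⊗ₙ-correct : ∀ m n → ⌊ m ⊗ₙ n ⌋ ≈ ⌊ m ⌋ ⊗ ⌊ n ⌋
  ⊗ₙ-correct (only X) (only Y) = test-++ X Y
  ⊗ₙ-correct (only X) (Y ▹ q) = ≈-sym (test-⊗-guarded X Y q)
  ⊗ₙ-correct (X ▹ p) (only Y) = ≈-trans (≈-sym (test-⊗-guarded Y X p)) (⊗-comm _ _)
  ⊗ₙ-correct (X ▹ p) (Y ▹ q) =
    ≈-trans (⊙-cong (test-++ X Y) ≈-refl) (≈-sym (guarded-⊗ (test≤𝟙 X) (test≤𝟙 Y) _ _))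

-- Finite sums of normal terms

∑ : List Normal → Term
∑ [] = 𝟘
∑ (n ∷ ns) = ⌊ n ⌋ ⊕ ∑ ns

∑-upper : ∀ {n ns} → n ∈ ns → ⌊ n ⌋ ≤ ∑ ns
∑-upper (here refl) = ⊕-upperˡ _ _
∑-upper (there n∈ns) = ≤-trans (∑-upper n∈ns) (⊕-upperʳ _ _)

∑-least : ∀ ns → (∀ {n} → n ∈ ns → ⌊ n ⌋ ≤ t) → ∑ ns ≤ t
∑-least [] bound = 𝟘-minimum _
∑-least (n ∷ ns) bound = ⊕-least (bound (here refl)) (∑-least ns (bound ∘′ there))

⊕-identityˡ : ∀ s → 𝟘 ⊕ s ≈ s
⊕-identityˡ s = ≤-antisym (⊕-least (𝟘-minimum s) ≤-refl) (⊕-upperʳ 𝟘 s)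

⊕-identityʳ : ∀ s → s ⊕ 𝟘 ≈ s
⊕-identityʳ s = ≤-antisym (⊕-least ≤-refl (𝟘-minimum s)) (⊕-upperˡ s 𝟘)

∑-++ : ∀ ms ns → ∑ (ms ++ ns) ≈ ∑ ms ⊕ ∑ ns
∑-++ [] ns = ≈-sym (⊕-identityˡ _)
∑-++ (m ∷ ms) ns =
  ≈-trans (⊕-cong ≈-refl (∑-++ ms ns)) (≈-sym (axiom +-assoc (instance₃ ⌊ m ⌋ (∑ ms) (∑ ns))))

-- Expansion of a product of two sums by distributivity, for an abstract operation because it serves
-- both meet and composition.
module ∑-Product
  (_∙_ : Term → Term → Term) (_∙ₙ_ : Normal → Normal → Normal)
  (∙ₙ-correct : ∀ m n → ⌊ m ∙ₙ n ⌋ ≈ ⌊ m ⌋ ∙ ⌊ n ⌋)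
  (distribˡ : ∀ s t u → s ∙ (t ⊕ u) ≈ (s ∙ t) ⊕ (s ∙ u))
  (distribʳ : ∀ s t u → (s ⊕ t) ∙ u ≈ (s ∙ u) ⊕ (t ∙ u))
  (zeroˡ : ∀ s → 𝟘 ∙ s ≈ 𝟘) (zeroʳ : ∀ s → s ∙ 𝟘 ≈ 𝟘)
  where

  ∑-map : ∀ m ns → ∑ (map (m ∙ₙ_) ns) ≈ ⌊ m ⌋ ∙ ∑ ns
  ∑-map m [] = ≈-sym (zeroʳ _)
  ∑-map m (n ∷ ns) = ≈-trans (⊕-cong (∙ₙ-correct m n) (∑-map m ns)) (≈-sym (distribˡ _ _ _))

  ∑-product : ∀ ms ns → ∑ (cartesianProductWith _∙ₙ_ ms ns) ≈ ∑ ms ∙ ∑ ns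
  ∑-product [] ns = ≈-sym (zeroˡ _)
  ∑-product (m ∷ ms) ns =
    ≈-trans (∑-++ (map (m ∙ₙ_) ns) _)
      (≈-trans (⊕-cong (∑-map m ns) (∑-product ms ns)) (≈-sym (distribʳ _ _ _)))

⊗-distribˡ-⊕ : ∀ s t u → s ⊗ (t ⊕ u) ≈ (s ⊗ t) ⊕ (s ⊗ u)
⊗-distribˡ-⊕ s t u = axiom distrib (instance₃ s t u)

⊗-distribʳ-⊕ : ∀ s t u → (s ⊕ t) ⊗ u ≈ (s ⊗ u) ⊕ (t ⊗ u)
⊗-distribʳ-⊕ s t u =
  ≈-trans (⊗-comm _ u) (≈-trans (⊗-distribˡ-⊕ u s t) (⊕-cong (⊗-comm u s) (⊗-comm u t)))

open ∑-Product _⊗_ _⊗ₙ_ ⊗ₙ-correct ⊗-distribˡ-⊕ ⊗-distribʳ-⊕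
  (λ s → ≈-sym (𝟘-minimum s)) (λ s → ≈-trans (⊗-comm s 𝟘) (≈-sym (𝟘-minimum s)))
  using () renaming (∑-product to ∑-⊗)

open ∑-Product _⊙_ _⊙ₙ_ ⊙ₙ-correct
  (λ s t u → axiom addʳ (instance₃ s t u)) (λ s t u → axiom addˡ (instance₃ s t u))
  (λ s → ≈-sym (axiom zero-∘ˡ (instance₁ s))) (λ s → ≈-sym (axiom zero-∘ʳ (instance₁ s)))
  using () renaming (∑-product to ∑-⊙)

normalise : Term → List Normal
-- The empty test is `𝟙`, so this summand reads `𝟙 ⊙ var i`.
normalise (var i) = ([] ▹ atom i) ∷ []
normalise (s ⊕ t) = normalise s ++ normalise t
normalise (s ⊗ t) = cartesianProductWith _⊗ₙ_ (normalise s) (normalise t)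
normalise (s ⊙ t) = cartesianProductWith _⊙ₙ_ (normalise s) (normalise t)
normalise 𝟘 = []
normalise 𝟙 = only [] ∷ []

∑-normalise : ∀ s → ∑ (normalise s) ≈ s
∑-normalise (var i) = ≈-trans (⊕-identityʳ _) (axiom ∘-idˡ (instance₁ (var i)))
∑-normalise (s ⊕ t) = ≈-trans (∑-++ (normalise s) _) (⊕-cong (∑-normalise s) (∑-normalise t))
∑-normalise (s ⊗ t) = ≈-trans (∑-⊗ (normalise s) _) (⊗-cong (∑-normalise s) (∑-normalise t))
∑-normalise (s ⊙ t) = ≈-trans (∑-⊙ (normalise s) _) (⊙-cong (∑-normalise s) (∑-normalise t))
∑-normalise 𝟘 = ≈-refl
∑-normalise 𝟙 = ⊕-identityʳ _

-- Soundness for languages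

module _ (𝔏 : LanguageAlgebra) where
  open LanguageAlgebra 𝔏 using (_⨾_)

  ε-⨾ : ∀ {L M w} → L [] → M w → (L ⨾ M) w
  ε-⨾ Lε Mw = [] , _ , refl , Lε , Mw

  ⨾-ε : ∀ {L M w} → L w → M [] → (L ⨾ M) w
  ⨾-ε {w = w} Lw Mε = w , [] , ≡.sym (++-identityʳ w) , Lw , Mε

  ⨾-swap-at-ε : ∀ {L M w} → w ≡ [] × (L ⨾ M) w → w ≡ [] × (M ⨾ L) w
  ⨾-swap-at-ε (refl , [] , [] , refl , Lε , Mε) = refl , [] , [] , refl , Mε , Lε

  language-model : ModelOfAx (toAlgebra 𝔏)
  language-model +-comm ρ w = mk⇔ swap-⊎ swap-⊎
  language-model ·-comm ρ w = mk⇔ swap swap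
  language-model +-assoc ρ w = mk⇔ assocʳ assocˡ
  language-model ·-assoc ρ w = mk⇔ assocʳ′ assocˡ′
  language-model +-absorb ρ w = mk⇔ [ id , proj₁ ]′ inj₁
  language-model ·-absorb ρ w = mk⇔ proj₁ (λ p → p , inj₁ p)
  language-model distrib ρ w = mk⇔
    (λ { (p , inj₁ q) → inj₁ (p , q) ; (p , inj₂ q) → inj₂ (p , q) })
    (λ { (inj₁ (p , q)) → p , inj₁ q ; (inj₂ (p , q)) → p , inj₂ q })
  language-model ∘-assoc ρ w = mk⇔
    (λ { (_ , w₃ , refl , (w₁ , w₂ , refl , p , q) , r) →
         w₁ , w₂ ++ w₃ , ++-assoc w₁ w₂ w₃ , p , w₂ , w₃ , refl , q , r })
    (λ { (w₁ , _ , refl , p , w₂ , w₃ , refl , q , r) →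
         w₁ ++ w₂ , w₃ , ≡.sym (++-assoc w₁ w₂ w₃) , (w₁ , w₂ , refl , p , q) , r })
  language-model ∘-idˡ ρ w = mk⇔ (λ { (_ , _ , refl , refl , p) → p }) (ε-⨾ refl)
  language-model ∘-idʳ ρ w = mk⇔
    (λ { (u , _ , refl , p , refl) → ≡.subst (proj₁ (ρ 0)) (≡.sym (++-identityʳ u)) p })
    (λ p → ⨾-ε p refl)
  language-model mono ρ w = mk⇔ proj₁
    (λ { d@(u , v , e , (p , _) , (q , _)) → d , u , v , e , p , q })
  language-model zero-· ρ w = mk⇔ (λ ()) proj₁
  language-model zero-∘ˡ ρ w = mk⇔ (λ ()) (λ { (_ , _ , _ , () , _) })
  language-model zero-∘ʳ ρ w = mk⇔ (λ ()) (λ { (_ , _ , _ , _ , ()) })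
  language-model ax1 ρ w = mk⇔
    (λ { (_ , _ , refl , (refl , p) , (refl , q)) → (refl , p) , q })
    (λ { ((refl , p) , q) → ε-⨾ (refl , p) (refl , q) })
  language-model ax2 ρ w = mk⇔
    (λ { (_ , _ , refl , (refl , p) , (q , r)) → ε-⨾ (refl , p) q , r })
    (λ { ((_ , _ , refl , (refl , p) , q) , r) → ε-⨾ (refl , p) (q , r) })
  language-model ax3 ρ w = mk⇔
    (λ { (u , _ , refl , (p , q) , (refl , r)) →
         ≡.subst (proj₁ (ρ 0)) (≡.sym (++-identityʳ u)) p , u , [] , refl , q , refl , r })
    (λ { (p , u , _ , refl , q , (refl , r)) →
         u , [] , refl , (≡.subst (proj₁ (ρ 0)) (++-identityʳ u) p , q) , refl , r })
  language-model ax4 ρ w = mk⇔ ⨾-swap-at-ε ⨾-swap-at-ε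
  language-model ax5 ρ w = mk⇔
    (λ { (_ , _ , refl , (refl , p) , q) → ⨾-ε q (refl , p) })
    (λ { (u , _ , refl , q , (refl , p)) → [] , u , ++-identityʳ u , (refl , p) , q })
  language-model addˡ ρ w = mk⇔
    (λ { (u , v , e , inj₁ p , q) → inj₁ (u , v , e , p , q)
       ; (u , v , e , inj₂ p , q) → inj₂ (u , v , e , p , q) })
    (λ { (inj₁ (u , v , e , p , q)) → u , v , e , inj₁ p , q
       ; (inj₂ (u , v , e , p , q)) → u , v , e , inj₂ p , q })
  language-model addʳ ρ w = mk⇔
    (λ { (u , v , e , p , inj₁ q) → inj₁ (u , v , e , p , q)
       ; (u , v , e , p , inj₂ q) → inj₂ (u , v , e , p , q) })
    (λ { (inj₁ (u , v , e , p , q)) → u , v , e , p , inj₁ q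
       ; (inj₂ (u , v , e , p , q)) → u , v , e , p , inj₂ q })
  language-model extra ρ w = mk⇔
    (λ { (([] , [] , refl , p , q) , refl) → ε-⨾ (p , refl) (q , refl) })
    (λ { (_ , _ , refl , (p , refl) , (q , refl)) → ε-⨾ p q , refl })

fullLanguageAlgebra : Set → LanguageAlgebra
fullLanguageAlgebra S = record
  { Alphabet = S
  ; InA = λ _ → ⊤
  ; ∪-closed = _
  ; ∩-closed = _
  ; ⨾-closed = _
  ; ∅-closed = _
  ; ε-closed = _
  }

member : Term → (ℕ → Language ℕ) → Language ℕ
member t ρ = proj₁ (⟦ toAlgebra (fullLanguageAlgebra ℕ) ⟧ t (λ i → ρ i , _))

infix 4 _⊨_

_⊨_ : Term → Term → Set₁
s ⊨ t = ∀ ρ w → member s ρ w → member t ρ w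

≤⇒⊨ : s ≤ t → s ⊨ t
≤⇒⊨ s≤t ρ w w∈s =
  proj₂ (Equivalence.to (≈-sound (toAlgebra 𝔏) (language-model 𝔏) s≤t (λ i → ρ i , _) w) w∈s)
  where 𝔏 = fullLanguageAlgebra ℕ

-- Interval words

-- The word lists `p`, `p + 1`, up to `q - 1`: the upper end is excluded, so adjacent intervals
-- concatenate and `[]` is the interval from any number to itself.
data Interval : ℕ → ℕ → List ℕ → Set where
  []  : ∀ {p} → Interval p p []
  _∷_ : ∀ p {q w} → Interval (suc p) q w → Interval p q (p ∷ w)

interval : ∀ {p q} → p ≤ℕ q → ∃ (Interval p q)
interval {p} p≤q = extend (ℕ.≤⇒≤′ p≤q)
  where
  snoc : ∀ {p q w} → Interval p q w → Interval p (suc q) (w ++ q ∷ [])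
  snoc [] = _ ∷ []
  snoc (p ∷ I) = p ∷ snoc I
  extend : ∀ {q} → p ≤′ q → ∃ (Interval p q)
  extend (≤′-reflexive refl) = [] , []
  extend (≤′-step p≤q) = _ , snoc (proj₂ (extend p≤q))

Interval-≤ : ∀ {p q w} → Interval p q w → p ≤ℕ q
Interval-≤ [] = ℕ.≤-refl
Interval-≤ (p ∷ I) = ℕ.<⇒≤ (Interval-≤ I)

Interval-++ : ∀ {p q r u v} → Interval p q u → Interval q r v → Interval p r (u ++ v)
Interval-++ [] J = J
Interval-++ (p ∷ I) J = p ∷ Interval-++ I J

Interval-++⁻ : ∀ {p r} u {v} → Interval p r (u ++ v) → ∃ λ q → Interval p q u × Interval q r v
Interval-++⁻ [] I = _ , [] , I
Interval-++⁻ (p ∷ u) (.p ∷ I) = let q , J , K = Interval-++⁻ u I in q , p ∷ J , K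

Interval-end : ∀ {p q q′ w} → Interval p q w → Interval p q′ w → q ≡ q′
Interval-end [] [] = refl
Interval-end (p ∷ I) (.p ∷ J) = Interval-end I J

Interval-[] : ∀ {p q} → Interval p q [] → p ≡ q
Interval-[] [] = refl

-- The first letter is the lower end, and the rest of the word then fixes the upper end; `p <ℕ q`
-- excludes `[]`, which would determine neither.
Interval-unique : ∀ {p q p′ q′ w} → p <ℕ q → Interval p q w → Interval p′ q′ w → p ≡ p′ × q ≡ q′
Interval-unique p<q [] J = contradiction p<q (ℕ.<-irrefl refl)
Interval-unique p<q (p ∷ I) (.p ∷ J) = refl , Interval-end I J

Interval-split : ∀ {p q r w} → p ≤ℕ q → q ≤ℕ r → Interval p r w →
                 ∃ λ u → ∃ λ v → w ≡ u ++ v × Interval p q u × Interval q r v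
Interval-split p≤q q≤r I with interval p≤q | interval q≤r
... | u , J | v , K = u , v , Interval-determined I (Interval-++ J K) , J , K
  where
  Interval-determined : ∀ {p q w w′} → Interval p q w → Interval p q w′ → w ≡ w′
  Interval-determined [] [] = refl
  Interval-determined [] (p ∷ J) = contradiction (Interval-≤ J) (ℕ.<-irrefl refl)
  Interval-determined (p ∷ I) [] = contradiction (Interval-≤ I) (ℕ.<-irrefl refl)
  Interval-determined (p ∷ I) (.p ∷ J) = ≡.cong (p ∷_) (Interval-determined I J)

-- Canonical language models

-- What the canonical model uses of a numbered graph. The relation `i ⟶ j` stands for reachability
-- by a nonempty path, not for adjacency; hence `label-split` includes transitivity.
record Frame : Set₁ where
  infix 4 _⟶_
  field
    Node : Set
    _⟶_ : Node → Node → Set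
    label : Node → Node → Term
    label-split : ∀ {i j k} → i ⟶ j → j ⟶ k → i ⟶ k × label i k ≤ label i j ⊙ label j k
    position : Node → ℕ
    position-injective : ∀ {i j} → position i ≡ position j → i ≡ j
    position-< : ∀ {i j} → i ⟶ j → position i <ℕ position j

module Canonical (σ : Term) (σ≤𝟙 : σ ≤ 𝟙) (F : Frame) where
  open Frame F

  -- Defined for every term, although the valuation takes it at variables only: on interval words it
  -- is the upper bound for the language of `t` that the induction establishes.
  data Forced (t : Term) : Language ℕ where
    empty : σ ≤ t → Forced t []
    path  : ∀ {i j w} → i ⟶ j → Interval (position i) (position j) w →
            σ ⊙ label i j ≤ t → Forced t w

  valuation : ℕ → Language ℕ
  valuation i = Forced (var i)

  Forced-≤ : ∀ {w} → s ≤ t → Forced s w → Forced t w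
  Forced-≤ s≤t (empty σ≤s) = empty (≤-trans σ≤s s≤t)
  Forced-≤ s≤t (path i⟶j I m≤s) = path i⟶j I (≤-trans m≤s s≤t)

  -- Positions increase strictly along `⟶`, so the word is nonempty; it then determines both
  -- positions, and by injectivity both nodes.
  Forced-path⁻ : ∀ {i j w} → i ⟶ j → Interval (position i) (position j) w → Forced t w →
                 σ ⊙ label i j ≤ t
  Forced-path⁻ i⟶j I (empty σ≤t) = contradiction (position-< i⟶j) (ℕ.<-irrefl (Interval-[] I))
  Forced-path⁻ i⟶j I (path k⟶l J m≤t) with Interval-unique (position-< i⟶j) I J
  ... | e , f with position-injective e | position-injective f
  ... | refl | refl = m≤t

  Forced-⊗ : ∀ {w} → Forced s w → Forced t w → Forced (s ⊗ t) w
  Forced-⊗ (empty σ≤s) (empty σ≤t) = empty (⊗-greatest σ≤s σ≤t)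
  Forced-⊗ (path i⟶j I m≤s) w∈t = path i⟶j I (⊗-greatest m≤s (Forced-path⁻ i⟶j I w∈t))
  -- This combination cannot occur, since the word of a path is never empty; `Forced-path⁻` contains
  -- the contradiction.
  Forced-⊗ w∈s@(empty _) (path i⟶j I m≤t) = path i⟶j I (⊗-greatest (Forced-path⁻ i⟶j I w∈s) m≤t)

  σ-idem : σ ≈ σ ⊙ σ
  σ-idem = ≈-sym (≈-trans (test-⊙-test σ≤𝟙 σ≤𝟙) (∧-idem σ))

  -- Idempotence of `σ` supplies one guard for each factor and centrality moves it into place. An
  -- empty factor absorbs a bare guard; two paths are joined by `label-split`.
  Forced-⊙ : ∀ {p q r u v} → Interval p q u → Interval q r v →
             Forced s u → Forced t v → Forced (s ⊙ t) (u ++ v)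
  Forced-⊙ I J (empty σ≤s) (empty σ≤t) = empty (≤-trans (≤-reflexive σ-idem) (⊙-mono σ≤s σ≤t))
  Forced-⊙ I J (empty σ≤s) (path {i} {j} i⟶j K m≤t) = path i⟶j K (begin
    σ ⊙ label i j        ≈⟨ ⊙-cong σ-idem ≈-refl ⟩
    (σ ⊙ σ) ⊙ label i j  ≈⟨ ⊙-assoc _ _ _ ⟩
    σ ⊙ (σ ⊙ label i j)  ≤⟨ ⊙-mono σ≤s m≤t ⟩
    _                    ∎)
    where open PartialOrderReasoning poset
  Forced-⊙ {u = u} I J (path {i} {j} i⟶j K m≤s) (empty σ≤t) =
    path i⟶j (≡.subst (Interval _ _) (≡.sym (++-identityʳ u)) K) (begin
    σ ⊙ label i j        ≈⟨ ⊙-cong σ-idem ≈-refl ⟩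
    (σ ⊙ σ) ⊙ label i j  ≈⟨ ⊙-assoc _ _ _ ⟩
    σ ⊙ (σ ⊙ label i j)  ≈⟨ test-central σ≤𝟙 _ ⟩
    (σ ⊙ label i j) ⊙ σ  ≤⟨ ⊙-mono m≤s σ≤t ⟩
    _                    ∎)
    where open PartialOrderReasoning poset
  Forced-⊙ I J (path {i} {j} i⟶j K m≤s) (path {j′} {k} j⟶k L m≤t)
    -- The first path ends and the second begins at the cut point `q` of the given intervals, hence
    -- at the same node.
    with position-injective (≡.trans (proj₂ (Interval-unique (position-< i⟶j) K I))
                                     (≡.sym (proj₁ (Interval-unique (position-< j⟶k) L J))))
  ... | refl = path (proj₁ (label-split i⟶j j⟶k)) (Interval-++ K L) (begin
    σ ⊙ label i k                        ≤⟨ ⊙-mono ≤-refl (proj₂ (label-split i⟶j j⟶k)) ⟩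
    σ ⊙ (label i j ⊙ label j k)          ≈⟨ ⊙-cong (∧-idem σ) ≈-refl ⟨
    (σ ⊗ σ) ⊙ (label i j ⊙ label j k)    ≈⟨ guarded-⊙ σ≤𝟙 σ≤𝟙 _ _ ⟨
    (σ ⊙ label i j) ⊙ (σ ⊙ label j k)    ≤⟨ ⊙-mono m≤s m≤t ⟩
    _                                    ∎)
    where open PartialOrderReasoning poset

  -- Restricting to intervals guarantees that in a factorisation u ++ v the path read by u
  -- ends at the node where the path read by v begins.
  member⇒Forced : ∀ t {p q w} → Interval p q w → member t valuation w → Forced t w
  member⇒Forced (var i) I w∈ = w∈
  member⇒Forced (s ⊕ t) I (inj₁ w∈s) = Forced-≤ (⊕-upperˡ s t) (member⇒Forced s I w∈s)
  member⇒Forced (s ⊕ t) I (inj₂ w∈t) = Forced-≤ (⊕-upperʳ s t) (member⇒Forced t I w∈t)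
  member⇒Forced (s ⊗ t) I (w∈s , w∈t) = Forced-⊗ (member⇒Forced s I w∈s) (member⇒Forced t I w∈t)
  member⇒Forced (s ⊙ t) I (u , v , refl , u∈s , v∈t) with Interval-++⁻ u I
  ... | _ , J , K = Forced-⊙ J K (member⇒Forced s J u∈s) (member⇒Forced t K v∈t)
  member⇒Forced 𝟙 I refl = empty σ≤𝟙

  test-member : ∀ X → σ ≤ test X → member (test X) valuation []
  test-member [] _ = refl
  test-member (i ∷ X) σ≤ =
    empty (≤-trans σ≤ (⊗-lowerˡ _ _)) , test-member X (≤-trans σ≤ (⊗-lowerʳ _ _))

-- The series-parallel graph of an SP term

-- The vertices other than the two terminals. `mid` is the vertex at which series composition glues
-- the sink of `p` to the source of `q`; parallel composition creates none.
data Inner : SP → Set where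
  mid : ∀ {p q} → Inner (p ⨟ q)
  ⨟ˡ  : ∀ {p q} → Inner p → Inner (p ⨟ q)
  ⨟ʳ  : ∀ {p q} → Inner q → Inner (p ⨟ q)
  ∧ˡ  : ∀ {p q} → Inner p → Inner (p ∧ q)
  ∧ʳ  : ∀ {p q} → Inner q → Inner (p ∧ q)

-- Reachability by a nonempty path; inner vertices in different branches of `p ∧ q` are
-- incomparable.
data _⟶ᵢ_ : ∀ {q} → Inner q → Inner q → Set where
  ⨟ˡ  : ∀ {p q} {i j : Inner p} → i ⟶ᵢ j → ⨟ˡ {q = q} i ⟶ᵢ ⨟ˡ j
  ⨟ʳ  : ∀ {p q} {i j : Inner q} → i ⟶ᵢ j → ⨟ʳ {p} i ⟶ᵢ ⨟ʳ j
  ⨟ˡᵐ : ∀ {p q} {i : Inner p} → ⨟ˡ {q = q} i ⟶ᵢ mid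
  ⨟ᵐʳ : ∀ {p q} {j : Inner q} → mid {p} ⟶ᵢ ⨟ʳ j
  ⨟ˡʳ : ∀ {p q} {i : Inner p} {j : Inner q} → ⨟ˡ i ⟶ᵢ ⨟ʳ j
  ∧ˡ  : ∀ {p q} {i j : Inner p} → i ⟶ᵢ j → ∧ˡ {q = q} i ⟶ᵢ ∧ˡ j
  ∧ʳ  : ∀ {p q} {i j : Inner q} → i ⟶ᵢ j → ∧ʳ {p} i ⟶ᵢ ∧ʳ j

-- The terms of the subgraphs before and after a vertex. For a vertex in one branch of `p ∧ q` the
-- other branch bypasses it and is dropped.
fromSource toSink : ∀ {q} → Inner q → Term
fromSource {p ⨟ q} mid = ⌜ p ⌝
fromSource (⨟ˡ i) = fromSource i
fromSource {p ⨟ q} (⨟ʳ j) = ⌜ p ⌝ ⊙ fromSource j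
fromSource (∧ˡ i) = fromSource i
fromSource (∧ʳ j) = fromSource j
toSink {p ⨟ q} mid = ⌜ q ⌝
toSink {p ⨟ q} (⨟ˡ i) = toSink i ⊙ ⌜ q ⌝
toSink (⨟ʳ j) = toSink j
toSink (∧ˡ i) = toSink i
toSink (∧ʳ j) = toSink j

-- Junk value 𝟘 on pairs not related by _⟶ᵢ_.
between : ∀ {q} → Inner q → Inner q → Term
between (⨟ˡ i) (⨟ˡ j) = between i j
between (⨟ˡ i) mid = toSink i
between (⨟ˡ i) (⨟ʳ j) = toSink i ⊙ fromSource j
between mid (⨟ʳ j) = fromSource j
between (⨟ʳ i) (⨟ʳ j) = between i j
between (∧ˡ i) (∧ˡ j) = between i j
between (∧ʳ i) (∧ʳ j) = between i j
between _ _ = 𝟘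

≤⊙-extendʳ : s ≤ r ⊙ t → ∀ u → s ⊙ u ≤ r ⊙ (t ⊙ u)
≤⊙-extendʳ s≤ u = ≤-trans (⊙-mono s≤ ≤-refl) (≤-reflexive (⊙-assoc _ _ _))

≤⊙-extendˡ : s ≤ r ⊙ t → ∀ u → u ⊙ s ≤ (u ⊙ r) ⊙ t
≤⊙-extendˡ s≤ u = ≤-trans (⊙-mono ≤-refl s≤) (≤-reflexive (≈-sym (⊙-assoc _ _ _)))

-- Cutting at `i` forgets the branches parallel to it, which is why only an inequality holds.
whole-split : ∀ {q} (i : Inner q) → ⌜ q ⌝ ≤ fromSource i ⊙ toSink i
whole-split mid = ≤-refl
whole-split (⨟ˡ i) = ≤⊙-extendʳ (whole-split i) _
whole-split (⨟ʳ j) = ≤⊙-extendˡ (whole-split j) _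
whole-split (∧ˡ i) = ≤-trans (⊗-lowerˡ _ _) (whole-split i)
whole-split (∧ʳ j) = ≤-trans (⊗-lowerʳ _ _) (whole-split j)

fromSource-split : ∀ {q} {i j : Inner q} → i ⟶ᵢ j → fromSource j ≤ fromSource i ⊙ between i j
fromSource-split (⨟ˡ e) = fromSource-split e
fromSource-split (⨟ʳ e) = ≤⊙-extendˡ (fromSource-split e) _
fromSource-split (⨟ˡᵐ {i = i}) = whole-split i
fromSource-split ⨟ᵐʳ = ≤-refl
fromSource-split (⨟ˡʳ {i = i}) = ≤⊙-extendʳ (whole-split i) _
fromSource-split (∧ˡ e) = fromSource-split e
fromSource-split (∧ʳ e) = fromSource-split e

toSink-split : ∀ {q} {i j : Inner q} → i ⟶ᵢ j → toSink i ≤ between i j ⊙ toSink j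
toSink-split (⨟ˡ e) = ≤⊙-extendʳ (toSink-split e) _
toSink-split (⨟ʳ e) = toSink-split e
toSink-split ⨟ˡᵐ = ≤-refl
toSink-split (⨟ᵐʳ {j = j}) = whole-split j
toSink-split (⨟ˡʳ {j = j}) = ≤⊙-extendˡ (whole-split j) _
toSink-split (∧ˡ e) = toSink-split e
toSink-split (∧ʳ e) = toSink-split e

between-split : ∀ {q} {i j k : Inner q} → i ⟶ᵢ j → j ⟶ᵢ k →
                i ⟶ᵢ k × between i k ≤ between i j ⊙ between j k
between-split (⨟ˡ d) (⨟ˡ e) = let f , b = between-split d e in ⨟ˡ f , b
between-split (⨟ˡ d) ⨟ˡᵐ = ⨟ˡᵐ , toSink-split d
between-split (⨟ˡ d) ⨟ˡʳ = ⨟ˡʳ , ≤⊙-extendʳ (toSink-split d) _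
between-split (⨟ʳ d) (⨟ʳ e) = let f , b = between-split d e in ⨟ʳ f , b
between-split ⨟ˡᵐ ⨟ᵐʳ = ⨟ˡʳ , ≤-refl
between-split ⨟ᵐʳ (⨟ʳ e) = ⨟ᵐʳ , fromSource-split e
between-split ⨟ˡʳ (⨟ʳ e) = ⨟ˡʳ , ≤⊙-extendˡ (fromSource-split e) _
between-split (∧ˡ d) (∧ˡ e) = let f , b = between-split d e in ∧ˡ f , b
between-split (∧ʳ d) (∧ʳ e) = let f , b = between-split d e in ∧ʳ f , b

-- Numbering of the inner vertices

size : SP → ℕ
size (atom i) = 0
size (p ⨟ q) = suc (size p) +ℕ size q
size (p ∧ q) = size p +ℕ size q

-- Vertices of the left part come first, then `mid`, then the right part, filling the numbers below
-- `size q`. The incomparable branches of `p ∧ q` also get disjoint ranges, so that the numbering is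
-- injective.
index : ∀ {q} → Inner q → ℕ
index {p ⨟ q} mid = size p
index (⨟ˡ i) = index i
index {p ⨟ q} (⨟ʳ j) = suc (size p) +ℕ index j
index (∧ˡ i) = index i
index {p ∧ q} (∧ʳ j) = size p +ℕ index j

index<size : ∀ {q} (i : Inner q) → index i <ℕ size q
index<size {p ⨟ q} mid = ℕ.m≤m+n _ _
index<size {p ⨟ q} (⨟ˡ i) = ℕ.<-≤-trans (index<size i) (ℕ.≤-trans (ℕ.n≤1+n _) (ℕ.m≤m+n _ _))
index<size {p ⨟ q} (⨟ʳ j) = ℕ.+-monoʳ-< (suc (size p)) (index<size j)
index<size {p ∧ q} (∧ˡ i) = ℕ.<-≤-trans (index<size i) (ℕ.m≤m+n _ _)
index<size {p ∧ q} (∧ʳ j) = ℕ.+-monoʳ-< (size p) (index<size j)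

index-< : ∀ {q} {i j : Inner q} → i ⟶ᵢ j → index i <ℕ index j
index-< (⨟ˡ e) = index-< e
index-< {p ⨟ q} (⨟ʳ e) = ℕ.+-monoʳ-< (suc (size p)) (index-< e)
index-< (⨟ˡᵐ {i = i}) = index<size i
index-< ⨟ᵐʳ = ℕ.m≤m+n _ _
index-< (⨟ˡʳ {i = i}) = ℕ.<-≤-trans (index<size i) (ℕ.≤-trans (ℕ.n≤1+n _) (ℕ.m≤m+n _ _))
index-< (∧ˡ e) = index-< e
index-< {p ∧ q} (∧ʳ e) = ℕ.+-monoʳ-< (size p) (index-< e)

index-injective : ∀ {q} (i j : Inner q) → index i ≡ index j → i ≡ j
index-injective mid mid e = refl
index-injective mid (⨟ˡ j) e = contradiction (≡.sym e) (ℕ.<⇒≢ (index<size j))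
index-injective mid (⨟ʳ j) e = contradiction e (ℕ.<⇒≢ (ℕ.m≤m+n _ _))
index-injective (⨟ˡ i) mid e = contradiction e (ℕ.<⇒≢ (index<size i))
index-injective (⨟ˡ i) (⨟ˡ j) e = ≡.cong ⨟ˡ (index-injective i j e)
index-injective (⨟ˡ i) (⨟ʳ j) e = contradiction e (ℕ.<⇒≢ (index-< (⨟ˡʳ {i = i} {j})))
index-injective (⨟ʳ i) mid e = contradiction (≡.sym e) (ℕ.<⇒≢ (ℕ.m≤m+n _ _))
index-injective (⨟ʳ i) (⨟ˡ j) e = contradiction (≡.sym e) (ℕ.<⇒≢ (index-< (⨟ˡʳ {i = j} {i})))
index-injective {p ⨟ q} (⨟ʳ i) (⨟ʳ j) e =
  ≡.cong ⨟ʳ (index-injective i j (ℕ.+-cancelˡ-≡ (suc (size p)) _ _ e))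
index-injective (∧ˡ i) (∧ˡ j) e = ≡.cong ∧ˡ (index-injective i j e)
index-injective (∧ˡ i) (∧ʳ j) e =
  contradiction e (ℕ.<⇒≢ (ℕ.<-≤-trans (index<size i) (ℕ.m≤m+n _ _)))
index-injective (∧ʳ i) (∧ˡ j) e =
  contradiction (≡.sym e) (ℕ.<⇒≢ (ℕ.<-≤-trans (index<size j) (ℕ.m≤m+n _ _)))
index-injective {p ∧ q} (∧ʳ i) (∧ʳ j) e =
  ≡.cong ∧ʳ (index-injective i j (ℕ.+-cancelˡ-≡ (size p) _ _ e))

-- The graph with its terminals

data Vertex (q : SP) : Set where
  source sink : Vertex q
  inner : Inner q → Vertex q

data _⟶_ {q : SP} : Vertex q → Vertex q → Set where
  source⟶sink  : source ⟶ sink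
  source⟶inner : ∀ {i} → source ⟶ inner i
  inner⟶sink   : ∀ {i} → inner i ⟶ sink
  inner⟶inner  : ∀ {i j} → i ⟶ᵢ j → inner i ⟶ inner j

-- Junk value 𝟘 on pairs not related by _⟶_.
label : ∀ {q} → Vertex q → Vertex q → Term
label {q} source sink = ⌜ q ⌝
label source (inner i) = fromSource i
label (inner i) sink = toSink i
label (inner i) (inner j) = between i j
label _ _ = 𝟘

label-split : ∀ {q} {i j k : Vertex q} → i ⟶ j → j ⟶ k → i ⟶ k × label i k ≤ label i j ⊙ label j k
label-split source⟶inner (inner⟶sink {i}) = source⟶sink , whole-split i
label-split source⟶inner (inner⟶inner e) = source⟶inner , fromSource-split e
label-split (inner⟶inner d) inner⟶sink = inner⟶sink , toSink-split d
label-split (inner⟶inner d) (inner⟶inner e) = let f , b = between-split d e in inner⟶inner f , b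

-- Indices are shifted by one to leave `0` to the source; the sink follows the last inner vertex.
position : ∀ {q} → Vertex q → ℕ
position source = 0
position {q} sink = suc (size q)
position (inner i) = suc (index i)

position-< : ∀ {q} {i j : Vertex q} → i ⟶ j → position i <ℕ position j
position-< source⟶sink = s≤s z≤n
position-< source⟶inner = s≤s z≤n
position-< (inner⟶sink {i}) = s≤s (index<size i)
position-< (inner⟶inner e) = s≤s (index-< e)

position-injective : ∀ {q} (i j : Vertex q) → position i ≡ position j → i ≡ j
position-injective source source e = refl
position-injective sink sink e = refl
position-injective sink (inner j) e = contradiction (≡.sym (ℕ.suc-injective e)) (ℕ.<⇒≢ (index<size j))
position-injective (inner i) sink e = contradiction (ℕ.suc-injective e) (ℕ.<⇒≢ (index<size i))
position-injective (inner i) (inner j) e = ≡.cong inner (index-injective i j (ℕ.suc-injective e))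

frame : SP → Frame
frame q = record
  { Node = Vertex q
  ; _⟶_ = _⟶_
  ; label = label
  ; label-split = label-split
  ; position = position
  ; position-injective = position-injective _ _
  ; position-< = position-<
  }

-- Serves for normal terms that are tests: without nodes only the clause `empty` of `Forced`
-- remains.
emptyFrame : Frame
emptyFrame = record
  { Node = ⊥
  ; _⟶_ = λ ()
  ; label = λ ()
  ; label-split = λ { {()} }
  ; position = λ ()
  ; position-injective = λ { {()} }
  ; position-< = λ { {()} }
  }

-- Subgraphs and the words they read

record Embedding (p q : SP) : Set where
  field
    vertex  : Vertex p → Vertex q
    edge    : ∀ {i j} → i ⟶ j → vertex i ⟶ vertex j
    label-≤ : ∀ {i j} → i ⟶ j → label (vertex i) (vertex j) ≤ label i j

open Embedding

embed-⨟ˡ : ∀ p q → Embedding p (p ⨟ q)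
embed-⨟ˡ p q .vertex source = source
embed-⨟ˡ p q .vertex sink = inner mid
embed-⨟ˡ p q .vertex (inner i) = inner (⨟ˡ i)
embed-⨟ˡ p q .edge source⟶sink = source⟶inner
embed-⨟ˡ p q .edge source⟶inner = source⟶inner
embed-⨟ˡ p q .edge inner⟶sink = inner⟶inner ⨟ˡᵐ
embed-⨟ˡ p q .edge (inner⟶inner e) = inner⟶inner (⨟ˡ e)
embed-⨟ˡ p q .label-≤ source⟶sink = ≤-refl
embed-⨟ˡ p q .label-≤ source⟶inner = ≤-refl
embed-⨟ˡ p q .label-≤ inner⟶sink = ≤-refl
embed-⨟ˡ p q .label-≤ (inner⟶inner e) = ≤-refl

embed-⨟ʳ : ∀ p q → Embedding q (p ⨟ q)
embed-⨟ʳ p q .vertex source = inner mid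
embed-⨟ʳ p q .vertex sink = sink
embed-⨟ʳ p q .vertex (inner j) = inner (⨟ʳ j)
embed-⨟ʳ p q .edge source⟶sink = inner⟶sink
embed-⨟ʳ p q .edge source⟶inner = inner⟶inner ⨟ᵐʳ
embed-⨟ʳ p q .edge inner⟶sink = inner⟶sink
embed-⨟ʳ p q .edge (inner⟶inner e) = inner⟶inner (⨟ʳ e)
embed-⨟ʳ p q .label-≤ source⟶sink = ≤-refl
embed-⨟ʳ p q .label-≤ source⟶inner = ≤-refl
embed-⨟ʳ p q .label-≤ inner⟶sink = ≤-refl
embed-⨟ʳ p q .label-≤ (inner⟶inner e) = ≤-refl

embed-∧ˡ : ∀ p q → Embedding p (p ∧ q)
embed-∧ˡ p q .vertex source = source
embed-∧ˡ p q .vertex sink = sink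
embed-∧ˡ p q .vertex (inner i) = inner (∧ˡ i)
embed-∧ˡ p q .edge source⟶sink = source⟶sink
embed-∧ˡ p q .edge source⟶inner = source⟶inner
embed-∧ˡ p q .edge inner⟶sink = inner⟶sink
embed-∧ˡ p q .edge (inner⟶inner e) = inner⟶inner (∧ˡ e)
-- Between the terminals the larger graph also has the other branch, so its label is a meet and lies
-- strictly in form below that of `p`; all other labels agree.
embed-∧ˡ p q .label-≤ source⟶sink = ⊗-lowerˡ _ _
embed-∧ˡ p q .label-≤ source⟶inner = ≤-refl
embed-∧ˡ p q .label-≤ inner⟶sink = ≤-refl
embed-∧ˡ p q .label-≤ (inner⟶inner e) = ≤-refl

embed-∧ʳ : ∀ p q → Embedding q (p ∧ q)
embed-∧ʳ p q .vertex source = source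
embed-∧ʳ p q .vertex sink = sink
embed-∧ʳ p q .vertex (inner j) = inner (∧ʳ j)
embed-∧ʳ p q .edge source⟶sink = source⟶sink
embed-∧ʳ p q .edge source⟶inner = source⟶inner
embed-∧ʳ p q .edge inner⟶sink = inner⟶sink
embed-∧ʳ p q .edge (inner⟶inner e) = inner⟶inner (∧ʳ e)
embed-∧ʳ p q .label-≤ source⟶sink = ⊗-lowerʳ _ _
embed-∧ʳ p q .label-≤ source⟶inner = ≤-refl
embed-∧ʳ p q .label-≤ inner⟶sink = ≤-refl
embed-∧ʳ p q .label-≤ (inner⟶inner e) = ≤-refl

-- The induction on `q` descends to subgraphs whose vertices keep their numbers and labels from the
-- surrounding graph. Hence the placement is arbitrary, and `realise` asks only for
-- `label i j ≤ var x`, a condition that survives restriction along an embedding.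
record Realisation (q : SP) (ρ : ℕ → Language ℕ) : Set where
  field
    place    : Vertex q → ℕ
    monotone : ∀ {i j} → i ⟶ j → place i ≤ℕ place j
    realise  : ∀ {i j x w} → i ⟶ j → label i j ≤ var x → Interval (place i) (place j) w → ρ x w

open Realisation

restrict : ∀ {p q ρ} → Embedding p q → Realisation q ρ → Realisation p ρ
restrict f R .place i = R .place (f .vertex i)
restrict f R .monotone e = R .monotone (f .edge e)
restrict f R .realise e l≤x = R .realise (f .edge e) (≤-trans (f .label-≤ e) l≤x)

SP-member : ∀ q {ρ w} (R : Realisation q ρ) →
            Interval (R .place source) (R .place sink) w → member ⌜ q ⌝ ρ w
SP-member (atom i) R I = R .realise source⟶sink ≤-refl I
SP-member (p ⨟ q) R I
  -- The word is cut at the place of `mid`.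
  with Interval-split (R .monotone (source⟶inner {i = mid})) (R .monotone inner⟶sink) I
... | u , v , e , J , K =
  u , v , e , SP-member p (restrict (embed-⨟ˡ p q) R) J , SP-member q (restrict (embed-⨟ʳ p q) R) K
SP-member (p ∧ q) R I =
  SP-member p (restrict (embed-∧ˡ p q) R) I , SP-member q (restrict (embed-∧ʳ p q) R) I

-- Completeness

-- The canonical model for the guard and the graph of `n` has a word in `⌊ n ⌋`, hence in `t`; that
-- this word is forced into `t` is the required inequality.
⊨⇒≤-normal : ∀ n → ⌊ n ⌋ ⊨ t → ⌊ n ⌋ ≤ t
-- The empty word is an interval at every number; `0` is an arbitrary choice.
⊨⇒≤-normal {t} (only X) n⊨t = at-ε (member⇒Forced t {0} [] (n⊨t valuation [] (test-member X ≤-refl)))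
  where
  open Canonical (test X) (test≤𝟙 X) emptyFrame
  at-ε : Forced t [] → test X ≤ t
  at-ε (empty σ≤t) = σ≤t
⊨⇒≤-normal {t} (X ▹ q) n⊨t with interval (ℕ.<⇒≤ (position-< (source⟶sink {q})))
... | w , I = Forced-path⁻ source⟶sink I (member⇒Forced t I (n⊨t valuation w w∈n))
  where
  open Canonical (test X) (test≤𝟙 X) (frame q)
  R : Realisation q valuation
  R .place = position
  R .monotone e = ℕ.<⇒≤ (position-< e)
  R .realise e l≤x J = path e J
    (≤-trans (⊙-mono (test≤𝟙 X) l≤x) (≤-reflexive (axiom ∘-idˡ (instance₁ _))))
  w∈n : member (test X ⊙ ⌜ q ⌝) valuation w
  w∈n = [] , w , refl , test-member X ≤-refl , SP-member q R I

-- Each normal summand of `s` is below `s`, so by soundness its language is contained in that of `s`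
-- and hence in that of `t`; the bounds for the summands add up.
⊨⇒≤ : ∀ s t → s ⊨ t → s ≤ t
⊨⇒≤ s t s⊨t = ≤-trans (≤-reflexive (≈-sym (∑-normalise s)))
  (∑-least (normalise s) λ {n} n∈ → ⊨⇒≤-normal n λ ρ w w∈n →
    s⊨t ρ w (≤⇒⊨ (≤-trans (∑-upper n∈) (≤-reflexive (∑-normalise s))) ρ w w∈n))

LangValid⇒≈ : ∀ s t → LangValid s t → s ≈ t
LangValid⇒≈ s t valid = ≤-antisym
  (⊨⇒≤ s t λ ρ w → Equivalence.to (valid 𝔏 (λ i → ρ i , _) w))
  (⊨⇒≤ t s λ ρ w → Equivalence.from (valid 𝔏 (λ i → ρ i , _) w))
  where 𝔏 = fullLanguageAlgebra ℕ

theorem2p3 : ∀ {a ℓ : Level} (A : Algebra a ℓ) → InVarietyLang A ⇔ ModelOfAx A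
theorem2p3 A = mk⇔
  (λ A∈V {s} {t} α → A∈V s t (λ 𝔏 → language-model 𝔏 α))
  -- Valid equations are derivable from `Ax`, and derivable equations hold in every model of `Ax`.
  (λ ⊨Ax s t valid → ≈-sound A ⊨Ax (LangValid⇒≈ s t valid))
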